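{- Let $\varphi$ be a non-erasing substitution on a finite alphabet $A$ extending over a letter $a_1$, and let $h\colon A\to B$ be a coding, $W=h(\varphi^{\infty}(a_1))$. There is an algorithm that decides whether the number of distinct $\varphi$-bounded factors of $\varphi^{\infty}(a_1)$ is finite. If this number is infinite, one can algorithmically decide whether $W$ is ultimately periodic. If it is finite, all these $\varphi$-bounded factors can be found algorithmically.
   Context: A substitution $\varphi\colon A^*\to A^*$ is non-erasing if no letter is mapped to the empty word; it extends over $a_1$ if $\varphi(a_1)=a_1v$ with $\varphi^k(v)\ne\varepsilon$ for all $k$, and then $\varphi^{\infty}(a_1)=a_1v\varphi(v)\varphi^2(v)\cdots$. A coding is a morphism mapping each letter to a single letter. A finite word $w\in A^*$ is $\varphi$-bounded if the sequence $w,\varphi(w),\varphi^2(w),\dots$ is ultimately periodic (equivalently, the lengths $|\varphi^n(w)|$ stay bounded); otherwise it is $\varphi$-growing. An infinite word is ultimately periodic if it has the form $wuuu\cdots$ with $w$ finite and $u$ nonempty. -}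

module Defs where

open import Data.Nat using (ℕ; zero; suc; _+_; _<_; _≤_)
open import Data.Fin using (Fin)
open import Data.List using (List; []; _∷_; concatMap; length; map; upTo)
open import Data.List.Membership.Propositional using (_∈_)
open import Data.Product using (Σ; ∃; _×_; _,_)
open import Data.Sum using (_⊎_)
open import Relation.Nullary using (¬_; Dec)
open import Relation.Binary.PropositionalEquality using (_≡_; _≢_)
open import Function.Bundles using (_⇔_)

Word : ℕ → Set
Word n = List (Fin n)

Subst : ℕ → Set
Subst n = Fin n → Word n

morph : ∀ {n} → Subst n → Word n → Word n
morph φ w = concatMap φ w

iter : ∀ {n} → Subst n → ℕ → Word n → Word n
iter φ zero    w = w
iter φ (suc k) w = morph φ (iter φ k w)

NonErasing : ∀ {n} → Subst n → Set
NonErasing φ = ∀ a → φ a ≢ []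

ExtendsOver : ∀ {n} → Subst n → Fin n → Set
ExtendsOver φ a₁ = Σ (Word _) λ v → (φ a₁ ≡ a₁ ∷ v) × (∀ k → iter φ k v ≢ [])

nth : ∀ {ℓ} {X : Set ℓ} → X → List X → ℕ → X
nth d []       i       = d
nth d (x ∷ xs) zero    = x
nth d (x ∷ xs) (suc i) = nth d xs i

InfWord : ℕ → Set
InfWord n = ℕ → Fin n

-- The fixed point φ^∞(a₁).  When φ extends over a₁, φ^{i+1}(a₁) = a₁ v φ(v) ⋯ φ^i(v)
-- has length ≥ i + 2, and it is a prefix of φ^∞(a₁), so its i-th letter is the
-- i-th letter of φ^∞(a₁).  (The default a₁ is never used in that case.)
fixpt : ∀ {n} → Subst n → Fin n → InfWord n
fixpt φ a₁ i = nth a₁ (iter φ (suc i) (a₁ ∷ [])) i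

code : ∀ {n m} → (Fin n → Fin m) → InfWord n → InfWord m
code h X i = h (X i)

window : ∀ {n} → InfWord n → ℕ → ℕ → Word n
window X i l = map (λ j → X (i + j)) (upTo l)

Factor : ∀ {n} → InfWord n → Word n → Set
Factor X u = ∃ λ i → u ≡ window X i (length u)

Bounded : ∀ {n} → Subst n → Word n → Set
Bounded φ w = ∃ λ p → ∃ λ q → (0 < q) × (∀ k → p ≤ k → iter φ (k + q) w ≡ iter φ k w)

FinitelyManyBoundedFactors : ∀ {n} → Subst n → InfWord n → Set
FinitelyManyBoundedFactors φ X =
  ∃ λ (L : List (Word _)) → ∀ u → Factor X u → Bounded φ u → u ∈ L

UltPeriodic : ∀ {m} → InfWord m → Set
UltPeriodic W = ∃ λ p → ∃ λ q → (0 < q) × (∀ k → p ≤ k → W (k + q) ≡ W k)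

{-# OPTIONS --safe #-}
-- A word is bounded iff all its letters are.  Consider the first growing letter of φᵏ(c), where k
-- runs over the multiples of a common period of all bounded letters: it recurs, giving
-- φᴾ(g) = y g z with y bounded.  If y = ε, the bounded prefixes of the φᵏ(c) have bounded length;
-- otherwise the φᵏ(c) contain all powers of one nonempty bounded word w.  The same holds for
-- suffixes.  If no letter occurring in X = φ^∞(a₁) yields such a w, then a long bounded factor of
-- φᵏ⁺¹(c) must lie inside the image φᵏ(b) of a single letter b of φ(c), whence by induction on k
-- bounded factors of X have bounded length, and they can be listed.  If w exists, X has infinitely
-- many bounded factors, and any ultimately periodic W must have |w| as an eventual period, because
-- a long power of w covers a whole period of W.  Whether |w| is an eventual period depends on the
-- sets of windows of length |w| + 1 starting in the blocks φᵏ(v) of X = a₁ v φ(v) φ²(v) ⋯; each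
-- set determines the next, so the sequence of sets is eventually periodic.
module Submission where

open import Defs
open import Data.Nat
open import Data.Nat.Properties
open import Data.Nat.DivMod using (_/_; _%_; m≡m%n+[m/n]*n; m%n<n)
open import Algebra.Properties.CommutativeSemigroup +-commutativeSemigroup using (xy∙z≈xz∙y)
open import Data.Fin using (Fin; toℕ; funToFin; finToFun)
open import Data.Fin.Properties using (pigeonhole; finToFun-funToFin) renaming (_≟_ to _≟ꟳ_)
open import Data.List using (List; []; _∷_; [_]; _++_; length; reverse; concat; concatMap; replicate;
  lookup; filter; allFin; upTo; applyUpTo; map; cartesianProductWith)
open import Data.List.Properties
open import Data.List.Extrema.Nat using (max; xs≤max)
import Data.List.Membership.DecPropositional as DecMembership
open import Data.List.Membership.Propositional using (_∈_; find; lose)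
open import Data.List.Membership.Propositional.Properties
open import Data.List.Relation.Unary.All as All using (All; []; _∷_)
import Data.List.Relation.Unary.All.Properties as All
open import Data.List.Relation.Unary.Any using (here; index)
open import Data.List.Relation.Unary.Any.Properties using (lookup-index)
open import Data.Product using (Σ; ∃; ∃₂; _×_; _,_; proj₁; proj₂)
open import Data.Sum using (_⊎_; inj₁; inj₂)
open import Data.Unit using (⊤; tt)
open import Function using (_∘_; case_of_)
open import Function.Bundles using (_⇔_; mk⇔)
open import Level using (Level)
open import Relation.Nullary using (¬_; Dec; yes; no; contradiction)
open import Relation.Nullary.Decidable using (map′; _×-dec_; _⊎-dec_; _→-dec_)
open import Relation.Binary.PropositionalEquality hiding ([_])

private variable
  ℓ ℓ′ : Level
  A : Set ℓ
  n : ℕ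

-- Splittings, first failures and powers of finite words.

++-split : ∀ (a c : List A) {b d} → a ++ b ≡ c ++ d →
  (∃ λ e → c ≡ a ++ e × b ≡ e ++ d) ⊎ (∃ λ e → a ≡ c ++ e × d ≡ e ++ b)
++-split []      c       eq = inj₁ (c , refl , eq)
++-split (x ∷ a) []      eq = inj₂ (x ∷ a , refl , sym eq)
++-split (x ∷ a) (y ∷ c) eq with refl , eq′ ← ∷-injective eq | ++-split a c eq′
... | inj₁ (e , refl , p) = inj₁ (e , refl , p)
... | inj₂ (e , refl , p) = inj₂ (e , refl , p)

length≤0⇒≡[] : ∀ (x : List A) → length x ≤ 0 → x ≡ []
length≤0⇒≡[] [] _ = refl

-- Each length bound forces the overlap `e` to be empty in one of the two cases of `++-split`.
++-cancel-lengths : ∀ (a c : List A) {b d} → a ++ b ≡ c ++ d →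
  length c ≤ length a → length d ≤ length b → a ≡ c × b ≡ d
++-cancel-lengths a c {b} {d} eq c≤a d≤b with ++-split a c eq
... | inj₁ (e , refl , refl)
  with refl ← length≤0⇒≡[] e (+-cancelˡ-≤ (length a) _ _
         (≤-trans (≤-reflexive (sym (length-++ a))) (≤-trans c≤a (≤-reflexive (sym (+-identityʳ _))))))
  = sym (++-identityʳ a) , refl
... | inj₂ (e , refl , refl)
  with refl ← length≤0⇒≡[] e (+-cancelʳ-≤ (length b) _ _
         (≤-trans (≤-reflexive (sym (length-++ e))) d≤b))
  = ++-identityʳ c , refl

nth-++ˡ : ∀ (d : A) xs {ys i} → i < length xs → nth d (xs ++ ys) i ≡ nth d xs i
nth-++ˡ d (x ∷ xs) {i = zero}  _         = refl
nth-++ˡ d (x ∷ xs) {i = suc i} (s≤s i<l) = nth-++ˡ d xs i<l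

nth-++ʳ : ∀ (d : A) xs {ys} i → nth d (xs ++ ys) (length xs + i) ≡ nth d ys i
nth-++ʳ d []       i = refl
nth-++ʳ d (x ∷ xs) i = nth-++ʳ d xs i

split-at : ∀ (xs : List A) {i} → i < length xs →
  ∃ λ x → ∃₂ λ y z → xs ≡ y ++ x ∷ z × length y ≡ i
split-at (x ∷ xs) {zero}  _ = x , [] , xs , refl , refl
split-at (x ∷ xs) {suc i} (s≤s i<l) with y , u , z , refl , refl ← split-at xs i<l
  = y , x ∷ u , z , refl , refl

first-failure : ∀ {P : A → Set ℓ′} → (∀ x → Dec (P x)) → ∀ w →
  All P w ⊎ (∃ λ y → ∃₂ λ g z → w ≡ y ++ g ∷ z × All P y × ¬ P g)
first-failure P? [] = inj₁ []
first-failure P? (x ∷ w) with P? x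
... | no ¬px = inj₂ ([] , x , w , refl , [] , ¬px)
... | yes px with first-failure P? w
...   | inj₁ all = inj₁ (px ∷ all)
...   | inj₂ (y , g , z , refl , ay , ¬pg) = inj₂ (x ∷ y , g , z , refl , px ∷ ay , ¬pg)

first-failure-unique : ∀ {P : A → Set ℓ′} y y′ {g g′ z z′} → y ++ g ∷ z ≡ y′ ++ g′ ∷ z′ →
  All P y → All P y′ → ¬ P g → ¬ P g′ → g ≡ g′
first-failure-unique []      []       refl _ _ _ _ = refl
first-failure-unique []      (_ ∷ _)  refl _ (p ∷ _) ¬g _ = contradiction p ¬g
first-failure-unique (_ ∷ _) []       refl (p ∷ _) _ _ ¬g′ = contradiction p ¬g′
first-failure-unique (_ ∷ y) (_ ∷ y′) eq (_ ∷ ay) (_ ∷ ay′) ¬g ¬g′ =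
  first-failure-unique y y′ (∷-injectiveʳ eq) ay ay′ ¬g ¬g′

length-prefix-before-failure : ∀ {P : A → Set ℓ′} y u {g z v} → y ++ g ∷ z ≡ u ++ v →
  All P u → ¬ P g → length u ≤ length y
length-prefix-before-failure y       []      _    _        _  = z≤n
length-prefix-before-failure []      (_ ∷ u) refl (p ∷ _)  ¬g = contradiction p ¬g
length-prefix-before-failure (_ ∷ y) (_ ∷ u) eq   (_ ∷ au) ¬g =
  s≤s (length-prefix-before-failure y u (∷-injectiveʳ eq) au ¬g)

pow : List A → ℕ → List A
pow w j = concat (replicate j w)

pow-suc : ∀ (w : List A) j → pow w (suc j) ≡ pow w j ++ w
pow-suc w zero    = ++-identityʳ w
pow-suc w (suc j) = trans (cong (w ++_) (pow-suc w j)) (sym (++-assoc w (pow w j) w))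

length-pow : ∀ (w : List A) j → length (pow w j) ≡ j * length w
length-pow w zero    = refl
length-pow w (suc j) = trans (length-++ w) (cong (length w +_) (length-pow w j))

All-pow : ∀ {P : A → Set ℓ′} {w} j → All P w → All P (pow w j)
All-pow zero    _  = []
All-pow (suc j) aw = All.++⁺ aw (All-pow j aw)

-- The power is read once as `w ++ pow w j` and once as `pow w j ++ w`; shifting by `length w`
-- passes from one reading to the other.
nth-pow : ∀ (d : A) w j {t} → length w + t < j * length w →
  nth d (pow w j) (length w + t) ≡ nth d (pow w j) t
nth-pow d w (suc j) {t} lt = begin
  nth d (w ++ pow w j) (length w + t) ≡⟨ nth-++ʳ d w t ⟩
  nth d (pow w j) t                   ≡⟨ nth-++ˡ d (pow w j) t<l ⟨
  nth d (pow w j ++ w) t              ≡⟨ cong (λ v → nth d v t) (pow-suc w j) ⟨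
  nth d (pow w (suc j)) t             ∎
  where
  open ≡-Reasoning
  t<l : t < length (pow w j)
  t<l = subst (t <_) (sym (length-pow w j)) (+-cancelˡ-< (length w) t _ lt)

reverse-pow : ∀ (w : List A) j → reverse (pow w j) ≡ pow (reverse w) j
reverse-pow w zero    = refl
reverse-pow w (suc j) = begin
  reverse (w ++ pow w j)             ≡⟨ reverse-++ w (pow w j) ⟩
  reverse (pow w j) ++ reverse w     ≡⟨ cong (_++ reverse w) (reverse-pow w j) ⟩
  pow (reverse w) j ++ reverse w     ≡⟨ pow-suc (reverse w) j ⟨
  pow (reverse w) (suc j)            ∎
  where open ≡-Reasoning

All-reverse : ∀ {P : A → Set ℓ′} w → All P w → All P (reverse w)
All-reverse [] _ = []
All-reverse {P = P} (x ∷ w) (px ∷ aw) =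
  subst (All P) (sym (unfold-reverse x w)) (All.++⁺ (All-reverse w aw) (px ∷ []))

-- Finite sets of letters.

Fin-bounded : (f : Fin n → ℕ) → ∃ λ M → ∀ a → f a ≤ M
Fin-bounded {zero}  f = 0 , λ ()
Fin-bounded {suc n} f with M , f≤M ← Fin-bounded (f ∘ Fin.suc) = f Fin.zero ⊔ M , λ where
  Fin.zero    → m≤m⊔n _ _
  (Fin.suc a) → ≤-trans (f≤M a) (m≤n⊔m _ _)

-- Finite choice in place of the excluded middle: an alternative at each letter becomes one global
-- alternative.
Fin-all-or : ∀ {P : Fin n → Set ℓ} {Q : Set ℓ′} → (∀ a → P a ⊎ Q) → (∀ a → P a) ⊎ Q
Fin-all-or {n = zero}  f = inj₁ λ ()
Fin-all-or {n = suc n} f with f Fin.zero | Fin-all-or (f ∘ Fin.suc)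
... | inj₂ q | _      = inj₂ q
... | _      | inj₂ q = inj₂ q
... | inj₁ p | inj₁ h = inj₁ λ where
  Fin.zero    → p
  (Fin.suc a) → h a

recurrence : (R : ℕ → Fin n → Set ℓ) → (∀ k → ∃ (R k)) → ∃₂ λ i j → i < j × ∃ λ g → R i g × R j g
recurrence {n = n} R r with pigeonhole (n<1+n n) (λ k → proj₁ (r (toℕ k)))
... | i , j , i<j , eq = toℕ i , toℕ j , i<j , proj₁ (r (toℕ i)) , proj₂ (r (toℕ i)) ,
  subst (R (toℕ j)) (sym eq) (proj₂ (r (toℕ j)))

-- Eventually periodic sequences

∸-+-shift : ∀ {i j k} → i < j → i ≤ k → (k ∸ i) + j ≡ k + (j ∸ i)
∸-+-shift {i} {j} {k} i<j i≤k = begin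
  (k ∸ i) + j               ≡⟨ cong ((k ∸ i) +_) (m+[n∸m]≡n (<⇒≤ i<j)) ⟨
  (k ∸ i) + (i + (j ∸ i))   ≡⟨ +-assoc (k ∸ i) i (j ∸ i) ⟨
  (k ∸ i) + i + (j ∸ i)     ≡⟨ cong (_+ (j ∸ i)) (m∸n+n≡m i≤k) ⟩
  k + (j ∸ i)               ∎
  where open ≡-Reasoning

module _ {i p : ℕ} (0<p : 0 < p) where

  residue : ∀ {k} → i ≤ k → ∃₂ λ r m → r < p × k ≡ (i + r) + m * p
  residue {k} i≤k = r , m , m%n<n (k ∸ i) p , (begin
    k                     ≡⟨ m+[n∸m]≡n i≤k ⟨
    i + (k ∸ i)           ≡⟨ cong (i +_) (m≡m%n+[m/n]*n (k ∸ i) p) ⟩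
    i + (r + m * p)       ≡⟨ +-assoc i r (m * p) ⟨
    (i + r) + m * p       ∎)
    where
    open ≡-Reasoning
    instance
      p≢0 : NonZero p
      p≢0 = >-nonZero 0<p
    r = (k ∸ i) % p
    m = (k ∸ i) / p

  module _ {P : ℕ → Set ℓ} where

    private
      step : ∀ k m → k + suc m * p ≡ (k + m * p) + p
      step k m = trans (cong (k +_) (+-comm p (m * p))) (sym (+-assoc k (m * p) p))

    ascend : (∀ k → i ≤ k → P k → P (k + p)) → ∀ {k} m → i ≤ k → P k → P (k + m * p)
    ascend up {k} zero    i≤k pk = subst P (sym (+-identityʳ k)) pk
    ascend up {k} (suc m) i≤k pk = subst P (sym (step k m))
      (up _ (≤-trans i≤k (m≤m+n k _)) (ascend up m i≤k pk))

    descend : (∀ k → i ≤ k → P (k + p) → P k) → ∀ {k} m → i ≤ k → P (k + m * p) → P k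
    descend down {k} zero    i≤k pk = subst P (+-identityʳ k) pk
    descend down {k} (suc m) i≤k pk =
      descend down m i≤k (down _ (≤-trans i≤k (m≤m+n k _)) (subst P (step k m) pk))

    -- Descending in steps of `p` moves any witness below `i + p`, so finitely many tests suffice.
    decide-∃ : (∀ k → i ≤ k → P (k + p) → P k) → (∀ k → Dec (P k)) → Dec (∃ P)
    decide-∃ down P? = map′ (λ (k , _ , pk) → k , pk) reduce (anyUpTo? P? (i + p))
      where
      reduce : ∃ P → ∃ λ k → k < i + p × P k
      reduce (k , pk) with i ≤? k
      ... | no i≰k = k , <-≤-trans (≰⇒> i≰k) (m≤m+n i p) , pk
      ... | yes i≤k with r , m , r<p , refl ← residue i≤k =
        i + r , +-monoʳ-< i r<p , descend down m (m≤m+n i r) pk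

    decide-eventually : (∀ k → i ≤ k → P k → P (k + p)) → (∀ k → i ≤ k → P (k + p) → P k) →
      (∀ k → Dec (P k)) → Dec (∃ λ k₀ → ∀ k → k₀ ≤ k → P k)
    decide-eventually up down P? = map′ to from (allUpTo? (λ r → P? (i + r)) p)
      where
      to : (∀ {r} → r < p → P (i + r)) → ∃ λ k₀ → ∀ k → k₀ ≤ k → P k
      to all = i , λ k i≤k → case residue i≤k of λ where
        (r , m , r<p , refl) → ascend up m (m≤m+n i r) (all r<p)
      from : (∃ λ k₀ → ∀ k → k₀ ≤ k → P k) → ∀ {r} → r < p → P (i + r)
      -- The multiple `k₀ * p` is at least `k₀`, so adding it to `i + r` reaches the range where `P`
      -- is known.
      from (k₀ , all) {r} _ = descend down k₀ (m≤m+n i r)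
        (all _ (≤-trans (m≤m*n k₀ p {{>-nonZero 0<p}}) (m≤n+m _ (i + r))))


indicator : ∀ {P : Set ℓ} → Dec P → Fin 2
indicator (yes _) = Fin.suc Fin.zero
indicator (no _)  = Fin.zero

indicator-≡ : ∀ {P : Set ℓ} {Q : Set ℓ′} (P? : Dec P) (Q? : Dec Q) → indicator P? ≡ indicator Q? → P → Q
indicator-≡ (yes _) (yes q) _ _ = q
indicator-≡ (no ¬p) _       _ p = contradiction p ¬p

-- Since U has finitely many subsets, some S i recurs, and from then on so do its successors.
module _ {A : Set ℓ} (U : List A) (S : ℕ → A → Set ℓ′)
  (S? : ∀ k x → Dec (S k x)) (S⊆U : ∀ k x → S k x → x ∈ U)
  (step : ∀ i j → (∀ x → S i x → S j x) → ∀ x → S (suc i) x → S (suc j) x) where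

  private
    -- The trace of `S k` on `U` as a bit vector, coded as a number so that the pigeonhole principle
    -- applies.
    signature : ℕ → Fin (2 ^ length U)
    signature k = funToFin (λ x → indicator (S? k (lookup U x)))

    signature-≡ : ∀ {k l} → signature k ≡ signature l → ∀ z →
      indicator (S? k (lookup U z)) ≡ indicator (S? l (lookup U z))
    signature-≡ eq z = trans (sym (finToFun-funToFin _ z))
      (trans (cong (λ c → finToFun c z) eq) (finToFun-funToFin _ z))

    signature-⊆ : ∀ {k l} → signature k ≡ signature l → ∀ x → S k x → S l x
    signature-⊆ {k} {l} eq x s = subst (S l) (sym x≡y) (indicator-≡ (S? k y) (S? l y)
      (signature-≡ eq (index x∈U)) (subst (S k) x≡y s))
      where
      x∈U = S⊆U k x s
      y = lookup U (index x∈U)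
      x≡y : x ≡ y
      x≡y = lookup-index x∈U

    iterated-step : ∀ {k l} m → (∀ x → S k x → S l x) → ∀ x → S (m + k) x → S (m + l) x
    iterated-step zero    h = h
    iterated-step (suc m) h = step _ _ (iterated-step m h)

  sets-eventually-periodic : ∃₂ λ i p → 0 < p ×
    (∀ k → i ≤ k → ∀ x → S k x → S (k + p) x) × (∀ k → i ≤ k → ∀ x → S (k + p) x → S k x)
  sets-eventually-periodic with pigeonhole (n<1+n (2 ^ length U)) (signature ∘ toℕ)
  ... | i , j , i<j , eq = toℕ i , toℕ j ∸ toℕ i , m<n⇒0<n∸m i<j ,
    (λ k i≤k x s → subst (λ m → S m x) (∸-+-shift i<j i≤k)
      (iterated-step (k ∸ toℕ i) (signature-⊆ eq) x (subst (λ m → S m x) (sym (m∸n+n≡m i≤k)) s))) ,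
    (λ k i≤k x s → subst (λ m → S m x) (m∸n+n≡m i≤k)
      (iterated-step (k ∸ toℕ i) (signature-⊆ (sym eq)) x (subst (λ m → S m x) (sym (∸-+-shift i<j i≤k)) s)))

-- Words under a non-erasing substitution

morph-++ : ∀ (φ : Subst n) x y → morph φ (x ++ y) ≡ morph φ x ++ morph φ y
morph-++ φ = concatMap-++ φ

morph-[] : ∀ (φ : Subst n) a → morph φ [ a ] ≡ φ a
morph-[] φ a = ++-identityʳ (φ a)

iter-++ : ∀ (φ : Subst n) k x y → iter φ k (x ++ y) ≡ iter φ k x ++ iter φ k y
iter-++ φ zero    x y = refl
iter-++ φ (suc k) x y = trans (cong (morph φ) (iter-++ φ k x y)) (morph-++ φ (iter φ k x) (iter φ k y))

iter-[] : ∀ (φ : Subst n) k → iter φ k [] ≡ []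
iter-[] φ zero    = refl
iter-[] φ (suc k) = cong (morph φ) (iter-[] φ k)

iter-+ : ∀ (φ : Subst n) k l w → iter φ (k + l) w ≡ iter φ k (iter φ l w)
iter-+ φ zero    l w = refl
iter-+ φ (suc k) l w = cong (morph φ) (iter-+ φ k l w)

iter-comm : ∀ (φ : Subst n) k l w → iter φ k (iter φ l w) ≡ iter φ l (iter φ k w)
iter-comm φ k l w = begin
  iter φ k (iter φ l w) ≡⟨ iter-+ φ k l w ⟨
  iter φ (k + l) w      ≡⟨ cong (λ m → iter φ m w) (+-comm k l) ⟩
  iter φ (l + k) w      ≡⟨ iter-+ φ l k w ⟩
  iter φ l (iter φ k w) ∎
  where open ≡-Reasoning

-- The body of `Bounded` with preperiod and period exposed, so that several words can share them.
PeriodicFrom : Subst n → ℕ → ℕ → Word n → Set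
PeriodicFrom φ p q w = ∀ k → p ≤ k → iter φ (k + q) w ≡ iter φ k w

periodicFrom-multiple : ∀ {φ : Subst n} {p q w} → PeriodicFrom φ p q w → ∀ m → PeriodicFrom φ p (m * q) w
periodicFrom-multiple {φ = φ} {w = w} per zero    k p≤k = cong (λ l → iter φ l w) (+-identityʳ k)
periodicFrom-multiple {φ = φ} {p} {q} {w} per (suc m) k p≤k = begin
  iter φ (k + (q + m * q)) w ≡⟨ cong (λ l → iter φ l w) (+-assoc k q (m * q)) ⟨
  iter φ (k + q + m * q) w   ≡⟨ periodicFrom-multiple per m (k + q) (≤-trans p≤k (m≤m+n k q)) ⟩
  iter φ (k + q) w           ≡⟨ per k p≤k ⟩
  iter φ k w                 ∎
  where open ≡-Reasoning

bounded-[] : ∀ {φ : Subst n} → Bounded φ []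
bounded-[] {φ = φ} = 0 , 1 , s≤s z≤n , λ k _ → trans (iter-[] φ (k + 1)) (sym (iter-[] φ k))

bounded-++ : ∀ {φ : Subst n} {x y} → Bounded φ x → Bounded φ y → Bounded φ (x ++ y)
bounded-++ {φ = φ} {x} {y} (p , q , 0<q , per) (p′ , q′ , 0<q′ , per′) =
  p ⊔ p′ , q′ * q , *-mono-≤ 0<q′ 0<q , λ k le → begin
    iter φ (k + q′ * q) (x ++ y)                     ≡⟨ iter-++ φ (k + q′ * q) x y ⟩
    iter φ (k + q′ * q) x ++ iter φ (k + q′ * q) y   ≡⟨ cong₂ _++_
      (periodicFrom-multiple per q′ k (≤-trans (m≤m⊔n p p′) le))
      (trans (cong (λ l → iter φ (k + l) y) (*-comm q′ q))
             (periodicFrom-multiple per′ q k (≤-trans (m≤n⊔m p p′) le))) ⟩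
    iter φ k x ++ iter φ k y                         ≡⟨ iter-++ φ k x y ⟨
    iter φ k (x ++ y)                                ∎
  where open ≡-Reasoning

bounded-iter⁻ : ∀ {φ : Subst n} k {w} → Bounded φ (iter φ k w) → Bounded φ w
bounded-iter⁻ {φ = φ} k {w} (p , q , 0<q , per) = p + k , q , 0<q , λ l p+k≤l →
  let l′ = l ∸ k
      p≤l′ = m+n≤o⇒m≤o∸n p p+k≤l
      l≡ = m∸n+n≡m (≤-trans (m≤n+m k p) p+k≤l)
  in begin
    iter φ (l + q) w             ≡⟨ cong (λ m → iter φ (m + q) w) l≡ ⟨
    iter φ (l′ + k + q) w        ≡⟨ cong (λ m → iter φ m w) (xy∙z≈xz∙y l′ k q) ⟩
    iter φ (l′ + q + k) w        ≡⟨ iter-+ φ (l′ + q) k w ⟩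
    iter φ (l′ + q) (iter φ k w) ≡⟨ per l′ p≤l′ ⟩
    iter φ l′ (iter φ k w)       ≡⟨ iter-+ φ l′ k w ⟨
    iter φ (l′ + k) w            ≡⟨ cong (λ m → iter φ m w) l≡ ⟩
    iter φ l w                   ∎
  where open ≡-Reasoning

bounded-iter⁺ : ∀ {φ : Subst n} k {w} → Bounded φ w → Bounded φ (iter φ k w)
bounded-iter⁺ {φ = φ} k {w} (p , q , 0<q , per) = p , q , 0<q , λ l p≤l → begin
  iter φ (l + q) (iter φ k w) ≡⟨ iter-comm φ (l + q) k w ⟩
  iter φ k (iter φ (l + q) w) ≡⟨ cong (iter φ k) (per l p≤l) ⟩
  iter φ k (iter φ l w)       ≡⟨ iter-comm φ k l w ⟩
  iter φ l (iter φ k w)       ∎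
  where open ≡-Reasoning

repetition⇒bounded : ∀ {φ : Subst n} {i j w} → i < j → iter φ i w ≡ iter φ j w → Bounded φ w
repetition⇒bounded {φ = φ} {i} {j} {w} i<j eq = i , j ∸ i , m<n⇒0<n∸m i<j , λ k i≤k → begin
  iter φ (k + (j ∸ i)) w      ≡⟨ cong (λ l → iter φ l w) (∸-+-shift i<j i≤k) ⟨
  iter φ ((k ∸ i) + j) w      ≡⟨ iter-+ φ (k ∸ i) j w ⟩
  iter φ (k ∸ i) (iter φ j w) ≡⟨ cong (iter φ (k ∸ i)) eq ⟨
  iter φ (k ∸ i) (iter φ i w) ≡⟨ iter-+ φ (k ∸ i) i w ⟨
  iter φ ((k ∸ i) + i) w      ≡⟨ cong (λ l → iter φ l w) (m∸n+n≡m i≤k) ⟩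
  iter φ k w                  ∎
  where open ≡-Reasoning

image-nonempty : ∀ (φ : Subst n) → NonErasing φ → ∀ a → 1 ≤ length (φ a)
image-nonempty φ ne a with φ a in eq
... | []    = contradiction eq (ne a)
... | _ ∷ _ = s≤s z≤n

length-morph : ∀ (φ : Subst n) → NonErasing φ → ∀ w → length w ≤ length (morph φ w)
length-morph φ ne []      = z≤n
length-morph φ ne (a ∷ w) = ≤-trans (+-mono-≤ (image-nonempty φ ne a) (length-morph φ ne w))
  (≤-reflexive (sym (length-++ (φ a))))

-- Every image has at least one letter, so a total length of at most `length w` leaves exactly one
-- letter for each.
tight-images : ∀ (φ : Subst n) → NonErasing φ → ∀ w → length (morph φ w) ≤ length w →
  All (λ b → length (φ b) ≡ 1) w
tight-images φ ne []      _  = []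
tight-images φ ne (a ∷ w) le =
  ≤-antisym (+-cancelʳ-≤ (length w) _ _ (≤-trans (+-monoʳ-≤ (length (φ a)) (length-morph φ ne w)) le′))
            (image-nonempty φ ne a)
  ∷ tight-images φ ne w (+-cancelˡ-≤ 1 _ _ (≤-trans (+-monoˡ-≤ _ (image-nonempty φ ne a)) le′))
  where
  le′ : length (φ a) + length (morph φ w) ≤ suc (length w)
  le′ = ≤-trans (≤-reflexive (sym (length-++ (φ a)))) le

-- Bounded letters and the decidability of boundedness.

module Boundedness {n} (φ : Subst n) (ne : NonErasing φ) where

  open DecMembership (_≟ꟳ_ {n}) using (_∈?_)

  length-iter : ∀ k w → length w ≤ length (iter φ k w)
  length-iter zero    w = ≤-refl
  length-iter (suc k) w = ≤-trans (length-iter k w) (length-morph φ ne (iter φ k w))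

  length-iter-mono : ∀ {k l} → k ≤ l → ∀ w → length (iter φ k w) ≤ length (iter φ l w)
  length-iter-mono {k} {l} k≤l w = ≤-trans (length-iter (l ∸ k) (iter φ k w))
    (≤-reflexive (cong length (trans (sym (iter-+ φ (l ∸ k) k w)) (cong (λ m → iter φ m w) (m∸n+n≡m k≤l)))))

  -- Lengths never decrease under `φ`, so when the concatenated iterates agree, neither part can
  -- have gained letters.
  periodicFrom-++⁻ : ∀ {p q} x {y} → PeriodicFrom φ p q (x ++ y) → PeriodicFrom φ p q x × PeriodicFrom φ p q y
  periodicFrom-++⁻ {p} {q} x {y} per = (λ k p≤k → proj₁ (both k p≤k)) , (λ k p≤k → proj₂ (both k p≤k))
    where
    both : ∀ k → p ≤ k → iter φ (k + q) x ≡ iter φ k x × iter φ (k + q) y ≡ iter φ k y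
    both k p≤k = ++-cancel-lengths (iter φ (k + q) x) (iter φ k x)
      (trans (sym (iter-++ φ (k + q) x y)) (trans (per k p≤k) (iter-++ φ k x y)))
      (length-iter-mono (m≤m+n k q) x) (length-iter-mono (m≤m+n k q) y)

  BoundedLetter : Fin n → Set
  BoundedLetter a = Bounded φ [ a ]

  bounded⁺ : ∀ {w} → All BoundedLetter w → Bounded φ w
  bounded⁺ []         = bounded-[]
  bounded⁺ (ba ∷ bw) = bounded-++ ba (bounded⁺ bw)

  periodicFrom⁻ : ∀ {p q} w → PeriodicFrom φ p q w → All (PeriodicFrom φ p q ∘ [_]) w
  periodicFrom⁻ []      _   = []
  periodicFrom⁻ (a ∷ w) per with pa , pw ← periodicFrom-++⁻ [ a ] per = pa ∷ periodicFrom⁻ w pw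

  bounded⁻ : ∀ {w} → Bounded φ w → All BoundedLetter w
  bounded⁻ {w} (p , q , 0<q , per) = All.map (λ pa → p , q , 0<q , pa) (periodicFrom⁻ w per)

  allBounded-iter : ∀ k {w} → All BoundedLetter w → All BoundedLetter (iter φ k w)
  allBounded-iter k = bounded⁻ ∘ bounded-iter⁺ k ∘ bounded⁺

  private
    -- A word is bounded exactly when all letters of its late iterates are rigid. This depends only
    -- on which letters occur in the iterates, hence can be decided.
    Rigid : Fin n → Set
    Rigid b = length (φ b) ≡ 1

    rigid-iter : ∀ {w} → (∀ k → All Rigid (iter φ k w)) → ∀ k → length (iter φ k w) ≡ length w
    rigid-iter {w} r zero    = refl
    rigid-iter {w} r (suc k) = trans (rigid-morph _ (r k)) (rigid-iter r k)
      where
      rigid-morph : ∀ u → All Rigid u → length (morph φ u) ≡ length u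
      rigid-morph []      []       = refl
      rigid-morph (a ∷ u) (e ∷ es) = trans (length-++ (φ a)) (cong₂ _+_ e (rigid-morph u es))

    rigid⇒boundedLetter : ∀ {b} → (∀ k → All Rigid (iter φ k [ b ])) → BoundedLetter b
    rigid⇒boundedLetter {b} r =
      let i , j , i<j , c , eq , eq′ = recurrence (λ k c → iter φ k [ b ] ≡ [ c ]) orbit
      in repetition⇒bounded i<j (trans eq (sym eq′))
      where
      singleton : ∀ (u : Word n) → length u ≡ 1 → ∃ λ c → u ≡ [ c ]
      singleton (c ∷ []) _ = c , refl
      orbit : ∀ k → ∃ λ c → iter φ k [ b ] ≡ [ c ]
      orbit k = singleton _ (rigid-iter r k)

    rigid⇒bounded : ∀ w → (∀ k → All Rigid (iter φ k w)) → Bounded φ w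
    rigid⇒bounded []      _ = bounded-[]
    rigid⇒bounded (a ∷ w) r = bounded-++
      (rigid⇒boundedLetter (λ k → All.++⁻ˡ (iter φ k [ a ]) (subst (All Rigid) (iter-++ φ k [ a ] w) (r k))))
      (rigid⇒bounded w (λ k → All.++⁻ʳ (iter φ k [ a ]) (subst (All Rigid) (iter-++ φ k [ a ] w) (r k))))

    eventuallyRigid⇒bounded : ∀ {w} → (∃ λ k₀ → ∀ k → k₀ ≤ k → All Rigid (iter φ k w)) → Bounded φ w
    eventuallyRigid⇒bounded {w} (k₀ , r) = bounded-iter⁻ k₀ (rigid⇒bounded _ λ k →
      subst (All Rigid) (iter-+ φ k k₀ w) (r (k + k₀) (m≤n+m k₀ k)))

    -- From the preperiod on, the lengths are periodic and non-decreasing, hence constant.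
    bounded⇒eventuallyRigid : ∀ {w} → Bounded φ w → ∃ λ k₀ → ∀ k → k₀ ≤ k → All Rigid (iter φ k w)
    bounded⇒eventuallyRigid {w} (p , q , 0<q , per) = p , λ k p≤k → tight-images φ ne _
      (≤-trans (length-iter-mono (≤-trans (≤-reflexive (+-comm 1 k)) (+-monoʳ-≤ k 0<q)) w)
               (≤-reflexive (cong length (per k p≤k))))

  -- The letters occurring in one iterate determine those in the next, so these sets are eventually
  -- periodic and one period of them settles eventual rigidity.
  bounded? : ∀ w → Dec (Bounded φ w)
  bounded? w =
    let i , p , 0<p , up , down = sets-eventually-periodic (allFin n) (λ k b → b ∈ iter φ k w)
          (λ k b → b ∈? iter φ k w) (λ _ b _ → ∈-allFin b) step
    in map′ eventuallyRigid⇒bounded bounded⇒eventuallyRigid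
        -- `All Rigid` passes to smaller sets of letters, hence each direction uses the opposite
        -- inclusion.
        (decide-eventually 0<p (λ k i≤k → transfer (down k i≤k)) (λ k i≤k → transfer (up k i≤k))
          (λ k → All.all? (λ b → length (φ b) ≟ 1) (iter φ k w)))
    where
    step : ∀ i j → (∀ b → b ∈ iter φ i w → b ∈ iter φ j w) → ∀ b → b ∈ iter φ (suc i) w → b ∈ iter φ (suc j) w
    step i j i⊆j b b∈ = ∈-concatMap⁺ φ (lose (i⊆j _ (proj₁ (proj₂ found))) (proj₂ (proj₂ found)))
      where found = find (∈-concatMap⁻ φ {xs = iter φ i w} b∈)
    transfer : ∀ {u v} → (∀ b → b ∈ v → b ∈ u) → All Rigid u → All Rigid v
    transfer v⊆u r = All.tabulate λ b∈v → All.lookup r (v⊆u _ b∈v)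

  boundedLetter? : ∀ a → Dec (BoundedLetter a)
  boundedLetter? a = bounded? [ a ]

  periodicFrom⁺ : ∀ {p q} {w} → All (PeriodicFrom φ p q ∘ [_]) w → PeriodicFrom φ p q w
  periodicFrom⁺ {q = q} []                k p≤k = trans (iter-[] φ (k + q)) (sym (iter-[] φ k))
  periodicFrom⁺ {q = q} {a ∷ w} (pa ∷ pw) k p≤k = trans (iter-++ φ (k + q) [ a ] w)
    (trans (cong₂ _++_ (pa k p≤k) (periodicFrom⁺ pw k p≤k)) (sym (iter-++ φ k [ a ] w)))

  -- The list of all bounded letters is itself a bounded word, and its preperiod and period serve
  -- each of its letters.
  uniformPeriod : ∃₂ λ p q → 0 < q × (∀ w → All BoundedLetter w → PeriodicFrom φ p q w)
  uniformPeriod = extend (bounded⁺ (All.all-filter boundedLetter? (allFin n)))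
    where
    extend : Bounded φ (filter boundedLetter? (allFin n)) →
      ∃₂ λ p q → 0 < q × (∀ w → All BoundedLetter w → PeriodicFrom φ p q w)
    extend (p , q , 0<q , per) = p , q , 0<q , λ w bw → periodicFrom⁺ (All.map
      (λ {a} ba → All.lookup (periodicFrom⁻ _ per) (∈-filter⁺ boundedLetter? (∈-allFin a) ba)) bw)

  length-iter-bounded : ∀ w → Bounded φ w → ∃ λ K → ∀ k → length (iter φ k w) ≤ K
  length-iter-bounded w (p , q , 0<q , per) = length (iter φ p w) , λ k →
    ≤-trans (length-iter-mono (≤-trans (m≤m*n k q {{>-nonZero 0<q}}) (m≤n+m (k * q) p)) w)
            (≤-reflexive (cong length (periodicFrom-multiple {φ = φ} per k p ≤-refl)))

  -- Bounded prefixes of iterates, and pumping.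

  PrefixBound SuffixBound : ℕ → Word n → Set
  PrefixBound K w = ∀ y z → w ≡ y ++ z → All BoundedLetter y → length y ≤ K
  SuffixBound K w = ∀ z y → w ≡ z ++ y → All BoundedLetter y → length y ≤ K

  ContainsAllPowers : Fin n → Word n → Set
  ContainsAllPowers c w = ∀ j → ∃ λ k → ∃₂ λ x z → iter φ k [ c ] ≡ x ++ pow w j ++ z

  Pumping : Fin n → Set
  Pumping c = ∃ λ w → 0 < length w × All BoundedLetter w × ContainsAllPowers c w

  first-growing : ∀ {c} → ¬ BoundedLetter c → ∀ k →
    ∃ λ g → ∃₂ λ y z → iter φ k [ c ] ≡ y ++ g ∷ z × All BoundedLetter y × ¬ BoundedLetter g
  first-growing {c} ¬bc k with first-failure boundedLetter? (iter φ k [ c ])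
  ... | inj₁ all = contradiction (bounded-iter⁻ k (bounded⁺ all)) ¬bc
  ... | inj₂ (y , g , z , dec) = g , y , z , dec

  iter-++∷ : ∀ k x c z → iter φ k (x ++ c ∷ z) ≡ iter φ k x ++ iter φ k [ c ] ++ iter φ k z
  iter-++∷ k x c z = trans (iter-++ φ k x (c ∷ z)) (cong (iter φ k x ++_) (iter-++ φ k [ c ] z))

  iter-fixes-pow : ∀ k {w} → iter φ k w ≡ w → ∀ j → iter φ k (pow w j) ≡ pow w j
  iter-fixes-pow k     fix zero    = iter-[] φ k
  iter-fixes-pow k {w} fix (suc j) = trans (iter-++ φ k w (pow w j)) (cong₂ _++_ fix (iter-fixes-pow k fix j))

  -- If φᴾ(g) = y g z, then on the image under φᵖ the prefix y becomes a word w fixed by φᴾ,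
  -- and each further application of φᴾ puts one more copy of w in front.
  module _ {p P g y z} (eq : iter φ P [ g ] ≡ y ++ g ∷ z) (per : PeriodicFrom φ p P y) where

    private
      w = iter φ p y
      d = iter φ p [ g ]

      fix : iter φ P w ≡ w
      fix = trans (sym (iter-+ φ P p y)) (trans (cong (λ k → iter φ k y) (+-comm P p)) (per p ≤-refl))

      image-d : iter φ P d ≡ w ++ d ++ iter φ p z
      image-d = trans (iter-comm φ P p [ g ]) (trans (cong (iter φ p) eq) (iter-++∷ p y g z))

    pump : ∀ j → ∃ λ z′ → iter φ (j * P) d ≡ pow w j ++ d ++ z′
    pump zero = [] , sym (++-identityʳ d)
    pump (suc j) with z′ , ih ← pump j = iter φ p z ++ iter φ P z′ , (begin
      iter φ (P + j * P) d                              ≡⟨ iter-+ φ P (j * P) d ⟩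
      iter φ P (iter φ (j * P) d)                       ≡⟨ cong (iter φ P) ih ⟩
      iter φ P (pow w j ++ d ++ z′)                     ≡⟨ iter-++ φ P (pow w j) (d ++ z′) ⟩
      iter φ P (pow w j) ++ iter φ P (d ++ z′)          ≡⟨ cong₂ _++_ (iter-fixes-pow P fix j) (iter-++ φ P d z′) ⟩
      pow w j ++ iter φ P d ++ iter φ P z′              ≡⟨ cong (λ v → pow w j ++ v ++ iter φ P z′) image-d ⟩
      pow w j ++ (w ++ d ++ iter φ p z) ++ iter φ P z′  ≡⟨ cong (pow w j ++_)
        (trans (++-assoc w (d ++ iter φ p z) _) (cong (w ++_) (++-assoc d (iter φ p z) _))) ⟩
      pow w j ++ w ++ d ++ iter φ p z ++ iter φ P z′    ≡⟨ ++-assoc (pow w j) w _ ⟨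
      (pow w j ++ w) ++ d ++ iter φ p z ++ iter φ P z′  ≡⟨ cong (_++ _) (pow-suc w j) ⟨
      pow w (suc j) ++ d ++ iter φ p z ++ iter φ P z′   ∎)
      where open ≡-Reasoning

    pump-from : ∀ {c i x x′} → iter φ i [ c ] ≡ x ++ g ∷ x′ → ContainsAllPowers c w
    pump-from {c} {i} {x} {x′} eqc j with z′ , eqd ← pump j = k + i , iter φ k x , d ++ z′ ++ iter φ k x′ , (begin
      iter φ (k + i) [ c ]                                   ≡⟨ trans (iter-+ φ k i [ c ]) (cong (iter φ k) eqc) ⟩
      iter φ k (x ++ g ∷ x′)                                 ≡⟨ iter-++∷ k x g x′ ⟩
      iter φ k x ++ iter φ k [ g ] ++ iter φ k x′            ≡⟨ cong (λ v → iter φ k x ++ v ++ iter φ k x′)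
        (trans (iter-+ φ (j * P) p [ g ]) eqd) ⟩
      iter φ k x ++ (pow w j ++ d ++ z′) ++ iter φ k x′      ≡⟨ cong (iter φ k x ++_)
        (trans (++-assoc (pow w j) (d ++ z′) _) (cong (pow w j ++_) (++-assoc d z′ _))) ⟩
      iter φ k x ++ pow w j ++ d ++ z′ ++ iter φ k x′        ∎)
      where
      open ≡-Reasoning
      k = j * P + p

  iter-keeps-head : ∀ {P g z} → iter φ P [ g ] ≡ g ∷ z → ∀ m → ∃ λ z′ → iter φ (m * P) [ g ] ≡ g ∷ z′
  iter-keeps-head {P} {g} {z} eq zero = [] , refl
  iter-keeps-head {P} {g} {z} eq (suc m) with z′ , ih ← iter-keeps-head eq m = z ++ iter φ P z′ ,
    trans (iter-+ φ P (m * P) [ g ]) (trans (cong (iter φ P) ih)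
      (trans (iter-++ φ P [ g ] z′) (cong (_++ iter φ P z′) eq)))

  -- A bounded prefix `u` of `φᵏ(c)` is pushed forward by `φᵐ` into `φ^(k * P + i)(c)`, which begins
  -- with `φ^(k * P)(x) g`. Its image stays bounded, so it ends before the growing letter `g`.
  iter-prefixBound : ∀ {c i P x g x′ z K} → 0 < P → iter φ i [ c ] ≡ x ++ g ∷ x′ → ¬ BoundedLetter g →
    iter φ P [ g ] ≡ g ∷ z → (∀ k → length (iter φ k x) ≤ K) → ∀ k → PrefixBound K (iter φ k [ c ])
  iter-prefixBound {c} {i} {P} {x} {g} {x′} {z} {K} 0<P eqc ¬bg eqg xK k u v eq bu with iter-keeps-head eqg k
  ... | z′ , eqz′ = begin
      length u                ≤⟨ length-iter m u ⟩
      length (iter φ m u)     ≤⟨ length-prefix-before-failure (iter φ (k * P) x) (iter φ m u) both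
                                  (allBounded-iter m bu) ¬bg ⟩
      length (iter φ (k * P) x) ≤⟨ xK (k * P) ⟩
      K                       ∎
    where
    open ≤-Reasoning
    m = (k * P + i) ∸ k
    m+k≡ : m + k ≡ k * P + i
    m+k≡ = m∸n+n≡m (≤-trans (m≤m*n k P {{>-nonZero 0<P}}) (m≤m+n (k * P) i))
    both : iter φ (k * P) x ++ g ∷ (z′ ++ iter φ (k * P) x′) ≡ iter φ m u ++ iter φ m v
    both = ≡.begin
      iter φ (k * P) x ++ g ∷ (z′ ++ iter φ (k * P) x′)
        ≡.≡⟨ cong (λ t → iter φ (k * P) x ++ t ++ iter φ (k * P) x′) eqz′ ⟨
      iter φ (k * P) x ++ iter φ (k * P) [ g ] ++ iter φ (k * P) x′
        ≡.≡⟨ iter-++∷ (k * P) x g x′ ⟨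
      iter φ (k * P) (x ++ g ∷ x′)
        ≡.≡⟨ cong (iter φ (k * P)) eqc ⟨
      iter φ (k * P) (iter φ i [ c ])
        ≡.≡⟨ trans (sym (iter-+ φ (k * P) i [ c ])) (cong (λ l → iter φ l [ c ]) (sym m+k≡)) ⟩
      iter φ (m + k) [ c ]
        ≡.≡⟨ trans (iter-+ φ m k [ c ]) (cong (iter φ m) eq) ⟩
      iter φ m (u ++ v)
        ≡.≡⟨ iter-++ φ m u v ⟩
      iter φ m u ++ iter φ m v
        ≡.∎
      where module ≡ = ≡-Reasoning

  -- The first growing letter of `φᴾ(g)` is preceded in `φ^(P + i)(c)` by bounded letters only, so
  -- it must be `g` again. The word `u` before it decides the alternative: empty gives the bound,
  -- nonempty can be pumped.
  repeated-growing-letter : ∀ {c i p P y g z y′ z′} → 0 < P → (∀ w → All BoundedLetter w → PeriodicFrom φ p P w) →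
    iter φ i [ c ] ≡ y ++ g ∷ z → All BoundedLetter y → ¬ BoundedLetter g →
    iter φ (P + i) [ c ] ≡ y′ ++ g ∷ z′ → All BoundedLetter y′ →
    (∃ λ K → ∀ k → PrefixBound K (iter φ k [ c ])) ⊎ Pumping c
  repeated-growing-letter {c} {i} {p} {P} {y} {g} {z} {y′} {z′} 0<P per eq by ¬bg eq′ by′
    with first-growing ¬bg P
  ... | g′ , u , v , eqg , bu , ¬bg′ = conclude u
          (subst (λ h → iter φ P [ g ] ≡ u ++ h ∷ v) (first-failure-unique (iter φ P y ++ u) y′ both
            (All.++⁺ (allBounded-iter P by) bu) by′ ¬bg′ ¬bg) eqg) bu
    where
    both : (iter φ P y ++ u) ++ g′ ∷ (v ++ iter φ P z) ≡ y′ ++ g ∷ z′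
    both = begin
      (iter φ P y ++ u) ++ g′ ∷ (v ++ iter φ P z)    ≡⟨ ++-assoc (iter φ P y) u _ ⟩
      iter φ P y ++ u ++ g′ ∷ (v ++ iter φ P z)      ≡⟨ cong (iter φ P y ++_) (++-assoc u (g′ ∷ v) _) ⟨
      iter φ P y ++ (u ++ g′ ∷ v) ++ iter φ P z      ≡⟨ cong (λ t → iter φ P y ++ t ++ iter φ P z) eqg ⟨
      iter φ P y ++ iter φ P [ g ] ++ iter φ P z     ≡⟨ iter-++∷ P y g z ⟨
      iter φ P (y ++ g ∷ z)                          ≡⟨ cong (iter φ P) eq ⟨
      iter φ P (iter φ i [ c ])                      ≡⟨ iter-+ φ P i [ c ] ⟨
      iter φ (P + i) [ c ]                           ≡⟨ eq′ ⟩
      y′ ++ g ∷ z′                                   ∎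
      where open ≡-Reasoning
    conclude : ∀ u → iter φ P [ g ] ≡ u ++ g ∷ v → All BoundedLetter u →
      (∃ λ K → ∀ k → PrefixBound K (iter φ k [ c ])) ⊎ Pumping c
    conclude []      eqg _  = let K , yK = length-iter-bounded y (bounded⁺ by)
      in inj₁ (K , iter-prefixBound {i = i} 0<P eq ¬bg eqg yK)
    conclude (b ∷ u) eqg bu = inj₂ (iter φ p (b ∷ u) , ≤-trans (s≤s z≤n) (length-iter p (b ∷ u)) ,
      allBounded-iter p bu , pump-from eqg (per (b ∷ u) bu) {i = i} eq)

  prefix-dichotomy : ∀ c → (∃ λ K → ∀ k → PrefixBound K (iter φ k [ c ])) ⊎ Pumping c
  prefix-dichotomy c with boundedLetter? c
  ... | yes bc = let K , cK = length-iter-bounded [ c ] bc in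
    inj₁ (K , λ k y z eq _ → ≤-trans (length-++-≤ˡ y) (≤-trans (≤-reflexive (cong length (sym eq))) (cK k)))
  ... | no ¬bc =
    -- Only exponents that are multiples of `q` are compared, so that the distance between two
    -- occurrences of `g` is a common period of all bounded letters.
    let p , q , 0<q , per = uniformPeriod
        i , j , i<j , g , (y , z , eq , by , ¬bg) , (y′ , z′ , eq′ , by′ , _) = recurrence
          (λ k g → ∃₂ λ y z → iter φ (k * q) [ c ] ≡ y ++ g ∷ z × All BoundedLetter y × ¬ BoundedLetter g)
          (λ k → first-growing ¬bc (k * q))
    in repeated-growing-letter {i = i * q} {P = (j ∸ i) * q} (*-mono-≤ (m<n⇒0<n∸m i<j) 0<q)
         (λ w bw → periodicFrom-multiple (per w bw) (j ∸ i)) eq by ¬bg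
         (trans (cong (λ k → iter φ k [ c ]) (trans (sym (*-distribʳ-+ q (j ∸ i) i))
           (cong (_* q) (m∸n+n≡m (<⇒≤ i<j))))) eq′) by′

  -- Uniform bound on the length of bounded factors.

  module _ {O : Fin n → Set} {S K} (O-closed : ∀ {a} → O a → All O (φ a)) (φ≤S : ∀ a → length (φ a) ≤ S)
    (prefix≤K : ∀ {a} → O a → ∀ k → PrefixBound K (iter φ k [ a ]))
    (suffix≤K : ∀ {a} → O a → ∀ k → SuffixBound K (iter φ k [ a ])) where

    private
      -- The prefix is cut along the images of the letters of `cs`; every piece is a bounded prefix
      -- of some `φᵏ(c)` and has length at most `K`.
      prefix-length : ∀ k {cs} → All O cs → ∀ u z → iter φ k cs ≡ u ++ z → All BoundedLetter u →
        length u ≤ length cs * K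
      prefix-length k [] u z eq _ with refl ← ++-conicalˡ u z (trans (sym eq) (iter-[] φ k)) = z≤n
      prefix-length k {c ∷ cs} (oc ∷ os) u z eq bu
        with ++-split (iter φ k [ c ]) u (trans (sym (iter-++ φ k [ c ] cs)) eq)
      ... | inj₁ (e , refl , eq′) = ≤-trans (≤-reflexive (length-++ (iter φ k [ c ])))
              (+-mono-≤ (prefix≤K oc k _ [] (sym (++-identityʳ _)) (All.++⁻ˡ _ bu))
                        (prefix-length k os e z eq′ (All.++⁻ʳ (iter φ k [ c ]) bu)))
      ... | inj₂ (e , eq′ , _) = ≤-trans (prefix≤K oc k u e eq′ bu) (m≤m+n K _)

      -- Either `u` lies inside the image of one letter, or it splits into a suffix of one image and
      -- a prefix of the images that follow. The second case gives a bound that does not involve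
      -- `M`.
      factor-length-word : ∀ {M} k →
        (∀ {c} → O c → ∀ x u z → iter φ k [ c ] ≡ x ++ u ++ z → All BoundedLetter u → length u ≤ M) →
        ∀ {cs} → All O cs → ∀ x u z → iter φ k cs ≡ x ++ u ++ z → All BoundedLetter u →
        length u ≤ M ⊎ length u ≤ length cs * K
      factor-length-word k ih [] x u z eq _
        with refl ← ++-conicalˡ u z (++-conicalʳ x _ (trans (sym eq) (iter-[] φ k))) = inj₁ z≤n
      factor-length-word k ih {c ∷ cs} (oc ∷ os) x u z eq bu
        with ++-split (iter φ k [ c ]) x (trans (sym (iter-++ φ k [ c ] cs)) eq)
      ... | inj₁ (e , _ , eq′) with factor-length-word k ih os e u z eq′ bu
      ...   | inj₁ le = inj₁ le
      ...   | inj₂ le = inj₂ (≤-trans le (m≤n+m _ K))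
      factor-length-word k ih {c ∷ cs} (oc ∷ os) x u z eq bu
          | inj₂ (e , eqc , eq′) with ++-split e u (sym eq′)
      ...   | inj₁ (e′ , refl , eq″) = inj₂ (≤-trans (≤-reflexive (length-++ e))
              (+-mono-≤ (suffix≤K oc k x e eqc (All.++⁻ˡ e bu))
                        (prefix-length k os e′ z eq″ (All.++⁻ʳ e bu))))
      ...   | inj₂ (e′ , refl , _) = inj₁ (ih oc x u e′ eqc bu)

    -- Since `φᵏ⁺¹(c)` is the image under `φᵏ` of the word `φ(c)`, a bounded factor lies in the
    -- image of one letter or has length at most `S * K`. The bound passes through the induction
    -- unchanged; the extra 1 covers `k = 0`.
    boundedFactor-length : ∀ k {c} → O c → ∀ x u z → iter φ k [ c ] ≡ x ++ u ++ z → All BoundedLetter u →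
      length u ≤ suc (S * K)
    boundedFactor-length zero _ x u z eq _ = ≤-trans (length-++-≤ˡ u)
      (≤-trans (length-++-≤ʳ (u ++ z) {x}) (≤-trans (≤-reflexive (cong length (sym eq))) (s≤s z≤n)))
    boundedFactor-length (suc k) {c} oc x u z eq bu
      with factor-length-word k (boundedFactor-length k) (O-closed oc) x u z
             (trans (cong (iter φ k) (sym (morph-[] φ c))) (trans (iter-comm φ k 1 [ c ]) eq)) bu
    ... | inj₁ le = le
    ... | inj₂ le = ≤-trans le (≤-trans (*-monoˡ-≤ K (φ≤S c)) (n≤1+n _))

-- Suffixes are reduced to prefixes by reading all words backwards.
mirror : Subst n → Subst n
mirror φ = reverse ∘ φ

mirror-nonErasing : ∀ {φ : Subst n} → NonErasing φ → NonErasing (mirror φ)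
mirror-nonErasing ne a eq = ne a (reverse-injective eq)

morph-mirror : ∀ (φ : Subst n) w → morph (mirror φ) (reverse w) ≡ reverse (morph φ w)
morph-mirror φ []      = refl
morph-mirror φ (a ∷ w) = begin
  morph (mirror φ) (reverse (a ∷ w))                            ≡⟨ cong (morph (mirror φ)) (unfold-reverse a w) ⟩
  morph (mirror φ) (reverse w ++ [ a ])                         ≡⟨ morph-++ (mirror φ) (reverse w) [ a ] ⟩
  morph (mirror φ) (reverse w) ++ morph (mirror φ) [ a ]        ≡⟨ cong₂ _++_ (morph-mirror φ w) (morph-[] (mirror φ) a) ⟩
  reverse (morph φ w) ++ reverse (φ a)                          ≡⟨ reverse-++ (φ a) (morph φ w) ⟨
  reverse (φ a ++ morph φ w)                                    ∎
  where open ≡-Reasoning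

iter-mirror : ∀ (φ : Subst n) k w → iter (mirror φ) k (reverse w) ≡ reverse (iter φ k w)
iter-mirror φ zero    w = refl
iter-mirror φ (suc k) w = trans (cong (morph (mirror φ)) (iter-mirror φ k w)) (morph-mirror φ (iter φ k w))

boundedLetter-mirror⁻ : ∀ {φ : Subst n} {a} → Bounded (mirror φ) [ a ] → Bounded φ [ a ]
boundedLetter-mirror⁻ {φ = φ} {a} (p , q , 0<q , per) = p , q , 0<q , λ k p≤k → reverse-injective
  (trans (sym (iter-mirror φ (k + q) [ a ])) (trans (per k p≤k) (iter-mirror φ k [ a ])))

boundedLetter-mirror⁺ : ∀ {φ : Subst n} {a} → Bounded φ [ a ] → Bounded (mirror φ) [ a ]
boundedLetter-mirror⁺ {φ = φ} {a} (p , q , 0<q , per) = p , q , 0<q , λ k p≤k →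
  trans (iter-mirror φ (k + q) [ a ]) (trans (cong reverse (per k p≤k)) (sym (iter-mirror φ k [ a ])))

module _ {n} (φ : Subst n) (ne : NonErasing φ) where

  open Boundedness φ ne
  private module Mirror = Boundedness (mirror φ) (mirror-nonErasing ne)

  suffix-dichotomy : ∀ c → (∃ λ K → ∀ k → SuffixBound K (iter φ k [ c ])) ⊎ Pumping c
  suffix-dichotomy c with Mirror.prefix-dichotomy c
  ... | inj₁ (K , bound) = inj₁ (K , λ k z y eq by → subst (_≤ K) (length-reverse y)
          (bound k (reverse y) (reverse z)
            (trans (iter-mirror φ k [ c ]) (trans (cong reverse eq) (reverse-++ z y)))
            (All-reverse y (All.map boundedLetter-mirror⁺ by))))
  ... | inj₂ (w , 0<w , bw , powers) = inj₂ (reverse w , subst (0 <_) (sym (length-reverse w)) 0<w ,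
          All-reverse w (All.map boundedLetter-mirror⁻ bw) , powers′)
    where
    powers′ : ContainsAllPowers c (reverse w)
    powers′ j with k , x , z , eq ← powers j = k , reverse z , reverse x , (begin
      iter φ k [ c ]                                    ≡⟨ reverse-involutive (iter φ k [ c ]) ⟨
      reverse (reverse (iter φ k [ c ]))                ≡⟨ cong reverse (trans (sym (iter-mirror φ k [ c ])) eq) ⟩
      reverse (x ++ pow w j ++ z)                       ≡⟨ reverse-++ x (pow w j ++ z) ⟩
      reverse (pow w j ++ z) ++ reverse x               ≡⟨ cong (_++ reverse x) (reverse-++ (pow w j) z) ⟩
      (reverse z ++ reverse (pow w j)) ++ reverse x     ≡⟨ ++-assoc (reverse z) (reverse (pow w j)) (reverse x) ⟩
      reverse z ++ reverse (pow w j) ++ reverse x       ≡⟨ cong (λ v → reverse z ++ v ++ reverse x) (reverse-pow w j) ⟩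
      reverse z ++ pow (reverse w) j ++ reverse x       ∎)
      where open ≡-Reasoning

-- Occurrences in infinite words

-- Occurrence by recursion on the word rather than through `window`, so that it splits and joins
-- along `_++_`.
At : ∀ {A : Set ℓ} → (ℕ → A) → ℕ → List A → Set ℓ
At X s []      = Level.Lift _ ⊤
At X s (x ∷ w) = X s ≡ x × At X (suc s) w

module _ {X : ℕ → A} where

  at-++⁻ : ∀ {s} x {y} → At X s (x ++ y) → At X s x × At X (s + length x) y
  at-++⁻ {s} []      {y} at        = Level.lift tt , subst (λ t → At X t y) (sym (+-identityʳ s)) at
  at-++⁻ {s} (a ∷ x) {y} (eq , at) with atx , aty ← at-++⁻ x at =
    (eq , atx) , subst (λ t → At X t y) (sym (+-suc s (length x))) aty

  at-++⁺ : ∀ {s} x {y} → At X s x → At X (s + length x) y → At X s (x ++ y)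
  at-++⁺ {s} []      {y} _          aty = subst (λ t → At X t y) (+-identityʳ s) aty
  at-++⁺ {s} (a ∷ x) {y} (eq , atx) aty = eq , at-++⁺ x atx (subst (λ t → At X t y) (+-suc s (length x)) aty)

  at⇒nth : ∀ d {s} w {i} → At X s w → i < length w → nth d w i ≡ X (s + i)
  at⇒nth d {s} (a ∷ w) {zero}  (eq , _)  _         = trans (sym eq) (cong X (sym (+-identityʳ s)))
  at⇒nth d {s} (a ∷ w) {suc i} (_ , atw) (s≤s i<l) = trans (at⇒nth d w atw i<l) (cong X (sym (+-suc s i)))

  nth⇒at : ∀ d {s} w → (∀ {i} → i < length w → nth d w i ≡ X (s + i)) → At X s w
  nth⇒at d     []      _ = Level.lift tt
  nth⇒at d {s} (a ∷ w) h = trans (cong X (sym (+-identityʳ s))) (sym (h (s≤s z≤n))) ,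
    nth⇒at d w (λ {i} i<l → trans (h (s≤s i<l)) (cong X (+-suc s i)))

  at⇒all : ∀ {s} w → At X s w → All (λ a → ∃ λ s → X s ≡ a) w
  at⇒all []      _          = []
  at⇒all (a ∷ w) (eq , atw) = (_ , eq) ∷ at⇒all w atw

  at-applyUpTo : ∀ {s} f l → (∀ j → X (s + j) ≡ f j) → At X s (applyUpTo f l)
  at-applyUpTo     f zero    h = Level.lift tt
  at-applyUpTo {s} f (suc l) h = trans (cong X (sym (+-identityʳ s))) (h 0) ,
    at-applyUpTo (f ∘ suc) l (λ j → trans (cong X (sym (+-suc s j))) (h (suc j)))

  at⇒≡applyUpTo : ∀ {s} f w → (∀ j → X (s + j) ≡ f j) → At X s w → w ≡ applyUpTo f (length w)
  at⇒≡applyUpTo     f []      h _          = refl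
  at⇒≡applyUpTo {s} f (a ∷ w) h (eq , atw) =
    cong₂ _∷_ (trans (sym eq) (trans (cong X (sym (+-identityʳ s))) (h 0)))
      (at⇒≡applyUpTo (f ∘ suc) w (λ j → trans (cong X (sym (+-suc s j))) (h (suc j))) atw)

module _ {X : InfWord n} where

  at-window : ∀ s l → At X s (window X s l)
  at-window s l = subst (At X s) (sym (map-upTo _ l)) (at-applyUpTo _ l (λ _ → refl))

  at⇒≡window : ∀ {s} w → At X s w → w ≡ window X s (length w)
  at⇒≡window w at = trans (at⇒≡applyUpTo _ w (λ _ → refl) at) (sym (map-upTo _ (length w)))

  length-window : ∀ s l → length (window X s l) ≡ l
  length-window s l = trans (length-map _ (upTo l)) (length-upTo l)

  window-≡ : ∀ {s t l i} → window X s l ≡ window X t l → i < l → X (s + i) ≡ X (t + i)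
  window-≡ {s} {t} {l} {i} eq i<l = trans
    (sym (at⇒nth (X 0) (window X s l) (at-window s l) i<len))
    (at⇒nth (X 0) (window X s l) (subst (At X t) (sym eq) (at-window t l)) i<len)
    where
    i<len : i < length (window X s l)
    i<len = subst (i <_) (sym (length-window s l)) i<l

  factor⁺ : ∀ {s} u → At X s u → Factor X u
  factor⁺ {s} u at = s , at⇒≡window u at

  at-middle : ∀ {s} x u {z} → At X s (x ++ u ++ z) → u ≡ window X (s + length x) (length u)
  at-middle x u at = at⇒≡window u (proj₁ (at-++⁻ u (proj₂ (at-++⁻ x at))))

  factor⁻ : ∀ {u} → Factor X u → ∃ λ s → At X s u
  factor⁻ (s , eq) = s , subst (At X s) (sym eq) (at-window s _)

split-length : ∀ (w : List A) {i} → i ≤ length w → ∃₂ λ x y → w ≡ x ++ y × length x ≡ i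
split-length w       {zero}  _         = [] , w , refl , refl
split-length (a ∷ w) {suc i} (s≤s i≤l) with x , y , refl , refl ← split-length w i≤l = a ∷ x , y , refl , refl

split-middle : ∀ (w : List A) i {l} → i + l ≤ length w →
  ∃ λ x → ∃₂ λ u z → w ≡ x ++ u ++ z × length x ≡ i × length u ≡ l
split-middle w i {l} le with x , y , refl , refl ← split-length w {i} (m+n≤o⇒m≤o i le)
  with u , z , refl , refl ← split-length y {l}
    (+-cancelˡ-≤ (length x) _ _ (≤-trans le (≤-reflexive (length-++ x))))
  = x , u , z , refl , refl , refl

words : ∀ n → ℕ → List (Word n)
words n zero    = [ [] ]
words n (suc l) = cartesianProductWith _∷_ (allFin n) (words n l)

∈-words : (w : Word n) → w ∈ words n (length w)
∈-words []      = here refl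
∈-words (a ∷ w) = ∈-cartesianProductWith⁺ _∷_ (∈-allFin a) (∈-words w)

-- The fixed point, its blocks, and images of positions.

module FixedPoint {n} (φ : Subst n) (ne : NonErasing φ) (a₁ : Fin n) (ext : ExtendsOver φ a₁) where

  open Boundedness φ ne

  X : InfWord n
  X = fixpt φ a₁

  prefix : ℕ → Word n
  prefix k = iter φ k [ a₁ ]

  prefix-suc : ∀ k → prefix (suc k) ≡ prefix k ++ iter φ k (proj₁ ext)
  prefix-suc k = begin
    morph φ (iter φ k [ a₁ ])                  ≡⟨ iter-comm φ k 1 [ a₁ ] ⟨
    iter φ k (morph φ [ a₁ ])                  ≡⟨ cong (iter φ k) (trans (morph-[] φ a₁) (proj₁ (proj₂ ext))) ⟩
    iter φ k (a₁ ∷ proj₁ ext)                  ≡⟨ iter-++ φ k [ a₁ ] (proj₁ ext) ⟩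
    prefix k ++ iter φ k (proj₁ ext)           ∎
    where open ≡-Reasoning

  -- The block of φ^∞(a₁) with index k is φᵏ(v), at the positions end k ≤ s < end (suc k).
  end : ℕ → ℕ
  end k = length (prefix k)

  end-< : ∀ k → end k < end (suc k)
  end-< k = begin-strict
    end k                                          <⟨ m<m+n (end k) (nonempty _ (proj₂ (proj₂ ext) k)) ⟩
    end k + length (iter φ k (proj₁ ext))          ≡⟨ length-++ (prefix k) ⟨
    length (prefix k ++ iter φ k (proj₁ ext))      ≡⟨ cong length (prefix-suc k) ⟨
    end (suc k)                                    ∎
    where
    open ≤-Reasoning
    nonempty : ∀ (w : Word n) → w ≢ [] → 0 < length w
    nonempty []      w≢[] = contradiction refl w≢[]
    nonempty (_ ∷ _) _    = s≤s z≤n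

  -- Position `k` thus lies inside `prefix k`, and the default letter of `fixpt` is never read.
  k<end : ∀ k → k < end k
  k<end zero    = s≤s z≤n
  k<end (suc k) = ≤-<-trans (k<end k) (end-< k)

  prefix-+ : ∀ m k → ∃ λ z → prefix (m + k) ≡ prefix k ++ z
  prefix-+ zero    k = [] , sym (++-identityʳ _)
  prefix-+ (suc m) k with z , eq ← prefix-+ m k = z ++ iter φ (m + k) (proj₁ ext) ,
    trans (prefix-suc (m + k)) (trans (cong (_++ iter φ (m + k) (proj₁ ext)) eq) (++-assoc (prefix k) z _))

  -- Both `prefix k` and `prefix (suc i)` are prefixes of `prefix (suc i + k)`, so their letters at
  -- `i` agree.
  at-prefix : ∀ k → At X 0 (prefix k)
  at-prefix k = nth⇒at a₁ (prefix k) λ {i} i<l →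
    let z , eq = prefix-+ (suc i) k
        z′ , eq′ = prefix-+ k (suc i)
    in begin
      nth a₁ (prefix k) i                 ≡⟨ nth-++ˡ a₁ (prefix k) i<l ⟨
      nth a₁ (prefix k ++ z) i            ≡⟨ cong (λ w → nth a₁ w i) eq ⟨
      nth a₁ (prefix (suc i + k)) i       ≡⟨ cong (λ m → nth a₁ (prefix m) i) (+-comm (suc i) k) ⟩
      nth a₁ (prefix (k + suc i)) i       ≡⟨ cong (λ w → nth a₁ w i) eq′ ⟩
      nth a₁ (prefix (suc i) ++ z′) i     ≡⟨ nth-++ˡ a₁ (prefix (suc i)) (<-trans (n<1+n i) (k<end (suc i))) ⟩
      nth a₁ (prefix (suc i)) i           ∎
    where open ≡-Reasoning

  -- The image under φ of the letter at position s starts at position image s.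
  image : ℕ → ℕ
  image zero    = 0
  image (suc s) = image s + length (φ (X s))

  image-+ : ∀ {s} w → At X s w → image s + length (morph φ w) ≡ image (s + length w)
  image-+ {s} []      _          = trans (+-identityʳ (image s)) (cong image (sym (+-identityʳ s)))
  image-+ {s} (a ∷ w) (refl , at) = begin
    image s + length (φ (X s) ++ morph φ w)          ≡⟨ cong (image s +_) (length-++ (φ (X s))) ⟩
    image s + (length (φ (X s)) + length (morph φ w)) ≡⟨ +-assoc (image s) _ _ ⟨
    image (suc s) + length (morph φ w)               ≡⟨ image-+ w at ⟩
    image (suc s + length w)                         ≡⟨ cong image (+-suc s (length w)) ⟨
    image (s + suc (length w))                       ∎
    where open ≡-Reasoning

  -- `prefix s` reaches position `s`; applying `φ` to it gives `prefix (suc s)`, where the image of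
  -- that letter starts after the images of the earlier ones.
  at-image : ∀ s → At X (image s) (φ (X s))
  at-image s with split-at (prefix s) (k<end s)
  ... | x , y , z , eq , refl with aty , refl , _ ← at-++⁻ y (subst (At X 0) eq (at-prefix s)) =
    proj₁ (at-++⁻ (φ x) (subst (λ t → At X t (φ x ++ morph φ z)) (image-+ y aty)
      (proj₂ (at-++⁻ (morph φ y) (subst (At X 0)
        (trans (cong (morph φ) eq) (morph-++ φ y (x ∷ z))) (at-prefix (suc s)))))))

  at-morph : ∀ {s} w → At X s w → At X (image s) (morph φ w)
  at-morph     []      _           = Level.lift tt
  at-morph {s} (a ∷ w) (refl , at) = at-++⁺ (φ (X s)) (at-image s) (at-morph w at)

  at-iter : ∀ {s} k w → At X s w → ∃ λ t → At X t (iter φ k w)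
  at-iter {s} zero    w at = s , at
  at-iter     (suc k) w at with t , at′ ← at-iter k w at = image t , at-morph _ at′

  Occurs : Fin n → Set
  Occurs a = ∃ λ s → X s ≡ a

  occurs-φ : ∀ {a} → Occurs a → All Occurs (φ a)
  occurs-φ (s , refl) = at⇒all _ (at-image s)

  -- `φ` maps each prefix to the next one, so block boundaries go to block boundaries.
  image-end : ∀ k → image (end k) ≡ end (suc k)
  image-end k = sym (image-+ (prefix k) (at-prefix k))

  image-mono : ∀ {s t} → s ≤ t → image s ≤ image t
  image-mono {s} {t} s≤t = subst (λ u → image s ≤ image u) (m∸n+n≡m s≤t) (go (t ∸ s))
    where
    go : ∀ m → image s ≤ image (m + s)
    go zero    = ≤-refl
    go (suc m) = ≤-trans (go m) (m≤m+n _ _)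

  locate : ∀ t → ∃₂ λ s o → o < length (φ (X s)) × t ≡ image s + o
  locate zero = 0 , 0 , image-nonempty φ ne (X 0) , refl
  locate (suc t) with s , o , o<l , refl ← locate t with suc o <? length (φ (X s))
  ... | yes so<l = s , suc o , so<l , sym (+-suc (image s) o)
  ... | no so≮l = suc s , 0 , image-nonempty φ ne (X (suc s)) ,
    trans (sym (+-suc (image s) o)) (trans (cong (image s +_) (≤-antisym o<l (≮⇒≥ so≮l))) (sym (+-identityʳ _)))

  -- Position `0` holds the initial `a₁`, which lies before every block.
  block-of : ∀ t → t < 1 ⊎ ∃ λ k → t < end (suc k) × end k ≤ t
  block-of zero    = inj₁ (s≤s z≤n)
  block-of (suc t) with block-of t
  ... | inj₁ (s≤s z≤n) = inj₂ (0 , end-< 0 , ≤-refl)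
  ... | inj₂ (k , t<e , e≤t) with suc t <? end (suc k)
  ...   | yes st<e = inj₂ (k , st<e , m≤n⇒m≤1+n e≤t)
  ...   | no st≮e  = inj₂ (suc k , ≤-<-trans t<e (end-< (suc k)) , ≮⇒≥ st≮e)

  -- A letter before `end i` has its whole image before `end (suc i)`.
  preimage-≥ : ∀ {i r o} → o < length (φ (X r)) → end (suc i) ≤ image r + o → end i ≤ r
  preimage-≥ {i} {r} {o} o<l e≤ = ≮⇒≥ λ r<e → <-irrefl refl (begin-strict
    image r + o      <⟨ +-monoʳ-< (image r) o<l ⟩
    image (suc r)    ≤⟨ image-mono r<e ⟩
    image (end i)    ≡⟨ image-end i ⟩
    end (suc i)      ≤⟨ e≤ ⟩
    image r + o      ∎)
    where open ≤-Reasoning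

  preimage-< : ∀ {i r o} → image r + o < end (suc i) → r < end i
  preimage-< {i} {r} {o} <e = ≰⇒> λ e≤r → <-irrefl refl (begin-strict
    image r + o      <⟨ <e ⟩
    end (suc i)      ≡⟨ image-end i ⟨
    image (end i)    ≤⟨ image-mono e≤r ⟩
    image r          ≤⟨ m≤m+n (image r) o ⟩
    image r + o      ∎)
    where open ≤-Reasoning

  -- Non-erasure makes the image of a window of length suc q determine every window of that
  -- length starting inside the image of its first letter.
  module _ {q : ℕ} where

    private
      fits : ∀ {a o} w → o < length (φ a) → o + suc (length w) ≤ length (morph φ (a ∷ w))
      fits {a} {o} w o<l = begin
        o + suc (length w)                      ≡⟨ +-suc o (length w) ⟩
        suc o + length w                        ≤⟨ +-mono-≤ o<l (length-morph φ ne w) ⟩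
        length (φ a) + length (morph φ w)       ≡⟨ length-++ (φ a) ⟨
        length (morph φ (a ∷ w))                ∎
        where open ≤-Reasoning

      window-image′ : ∀ {s t o} (w : Word n) → length w ≡ suc q → At X s w → At X t w → o < length (φ (X s)) →
        window X (image s + o) (suc q) ≡ window X (image t + o) (suc q)
      window-image′ {s} {t} {o} (a ∷ w) refl ats@(refl , _) att o<l
        with x , u , z , eq , refl , len ← split-middle (morph φ (X s ∷ w)) o (fits w o<l)
        = trans (sym (occurrence ats)) (occurrence att)
        where
        occurrence : ∀ {r} → At X r (X s ∷ w) → u ≡ window X (image r + length x) (suc q)
        occurrence {r} at = subst (λ l → u ≡ window X (image r + length x) l) len
          (at-middle x u (subst (At X (image r)) eq (at-morph _ at)))

    window-image : ∀ {s t o} → window X s (suc q) ≡ window X t (suc q) → o < length (φ (X s)) →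
      window X (image s + o) (suc q) ≡ window X (image t + o) (suc q)
    window-image {s} {t} eq = window-image′ (window X s (suc q)) (length-window {X = X} s (suc q))
      (at-window {X = X} s (suc q)) (subst (At X t) (sym eq) (at-window {X = X} t (suc q)))

    -- Only the start of the window is confined to the block. With length `suc q` the window has a
    -- first letter whose image can be located, and it shows both `X s` and `X (s + q)`.
    InBlock : ℕ → Word n → Set
    InBlock k u = ∃ λ s → s < end (suc k) × end k ≤ s × u ≡ window X s (suc q)

    inBlock? : ∀ k u → Dec (InBlock k u)
    inBlock? k u = anyUpTo? (λ s → (end k ≤? s) ×-dec (≡-dec _≟ꟳ_ u (window X s (suc q)))) (end (suc k))

    inBlock-words : ∀ k u → InBlock k u → u ∈ words n (suc q)
    inBlock-words k u (s , _ , _ , refl) =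
      subst (λ l → window X s (suc q) ∈ words n l) (length-window {X = X} s (suc q)) (∈-words _)

    -- The window starts inside the image of a letter `X r` of block `i`. The window at `r` recurs
    -- at some `t` of block `j`, and the same offset inside the image of `X t` gives the required
    -- window.
    inBlock-suc : ∀ i j → (∀ u → InBlock i u → InBlock j u) → ∀ u → InBlock (suc i) u → InBlock (suc j) u
    inBlock-suc i j i⊆j u (s , s<e , e≤s , refl) with r , o , o<l , refl ← locate s
      with t , t<e , e≤t , eq ← i⊆j (window X r (suc q))
        (r , preimage-< {suc i} s<e , preimage-≥ {i} o<l e≤s , refl)
      = image t + o , below , ≤-trans (≤-reflexive (sym (image-end j))) (≤-trans (image-mono e≤t) (m≤m+n _ o)) ,
        window-image {r} {t} eq o<l
      where
      open ≤-Reasoning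
      X≡ : X r ≡ X t
      X≡ = trans (cong X (sym (+-identityʳ r)))
        (trans (window-≡ {X = X} {s = r} {t = t} eq (s≤s z≤n)) (cong X (+-identityʳ t)))
      below : image t + o < end (suc (suc j))
      below = begin-strict
        image t + o                    <⟨ +-monoʳ-< (image t) (subst (λ a → o < length (φ a)) X≡ o<l) ⟩
        image (suc t)                  ≤⟨ image-mono t<e ⟩
        image (end (suc j))            ≡⟨ image-end (suc j) ⟩
        end (suc (suc j))              ∎

    inBlock-periodic : ∃₂ λ i p → 0 < p ×
      (∀ k → i ≤ k → ∀ u → InBlock k u → InBlock (k + p) u) × (∀ k → i ≤ k → ∀ u → InBlock (k + p) u → InBlock k u)
    inBlock-periodic = sets-eventually-periodic (words n (suc q)) InBlock inBlock? inBlock-words inBlock-suc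

  -- Decision procedures for factors and eventual periods.

  factor? : ∀ u → Dec (Factor X u)
  factor? [] = yes (0 , refl)
  factor? u@(_ ∷ v) =
    -- Membership in blocks is eventually periodic, so finitely many blocks are searched; the window
    -- at `0`, which starts in no block, is tested separately.
    let i , p , 0<p , _ , down = inBlock-periodic {q = length v}
    in map′ to from (≡-dec _≟ꟳ_ u (window X 0 (length u)) ⊎-dec
         decide-∃ 0<p (λ k i≤k → down k i≤k u) (λ k → inBlock? k u))
    where
    to : u ≡ window X 0 (length u) ⊎ (∃ λ k → InBlock k u) → Factor X u
    to (inj₁ eq)                   = 0 , eq
    to (inj₂ (_ , s , _ , _ , eq)) = s , eq
    from : Factor X u → u ≡ window X 0 (length u) ⊎ (∃ λ k → InBlock k u)
    from (s , eq) with block-of s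
    ... | inj₁ (s≤s z≤n)       = inj₁ eq
    ... | inj₂ (k , s<e , e≤s) = inj₂ (k , s , s<e , e≤s , eq)

  occurs? : ∀ a → Dec (Occurs a)
  occurs? a = map′ (λ f → let s , eq , _ = factor⁻ {X = X} {u = [ a ]} f in s , eq)
    (λ (s , eq) → factor⁺ {X = X} {s} [ a ] (eq , Level.lift tt)) (factor? [ a ])

  module _ {m} (h : Fin n → Fin m) where

    EventualPeriod : ℕ → Set
    EventualPeriod q = ∃ λ p → ∀ k → p ≤ k → code h X (k + q) ≡ code h X k

    -- Whether `q` is a period throughout block `k` is read off the first and last letters of its
    -- windows of length `suc q`, so it inherits the eventual periodicity of the sets of windows.
    eventualPeriod? : ∀ q → Dec (EventualPeriod q)
    eventualPeriod? q =
      let i , p , 0<p , up , down = inBlock-periodic {q = q}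
      in map′ to from (decide-eventually 0<p (λ k i≤k → transfer {k} {k + p} (down k i≤k))
           (λ k i≤k → transfer {k + p} {k} (up k i≤k))
           (λ k → allUpTo? (λ s → (end k ≤? s) →-dec (code h X (s + q) ≟ꟳ code h X s)) (end (suc k))))
      where
      PeriodicBlock : ℕ → Set
      PeriodicBlock k = ∀ {s} → s < end (suc k) → end k ≤ s → code h X (s + q) ≡ code h X s

      transfer : ∀ {k l} → (∀ u → InBlock {q} l u → InBlock {q} k u) → PeriodicBlock k → PeriodicBlock l
      transfer l⊆k per {s} s<e e≤s with t , t<e , e≤t , eq ← l⊆k _ (s , s<e , e≤s , refl) = begin
        h (X (s + q))   ≡⟨ cong h (window-≡ {X = X} {s = s} {t = t} eq (n<1+n q)) ⟩
        h (X (t + q))   ≡⟨ per t<e e≤t ⟩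
        h (X t)         ≡⟨ cong (h ∘ X) (+-identityʳ t) ⟨
        h (X (t + 0))   ≡⟨ cong h (window-≡ {X = X} {s = s} {t = t} eq (s≤s z≤n)) ⟨
        h (X (s + 0))   ≡⟨ cong (h ∘ X) (+-identityʳ s) ⟩
        h (X s)         ∎
        where open ≡-Reasoning

      end-mono : ∀ {k l} → k ≤ l → end k ≤ end l
      end-mono {k} {l} k≤l = length-iter-mono k≤l [ a₁ ]

      to : (∃ λ k₀ → ∀ k → k₀ ≤ k → PeriodicBlock k) → EventualPeriod q
      to (k₀ , per) = end k₀ , λ s e≤s → case block-of s of λ where
        (inj₁ (s≤s z≤n))       → contradiction (≤-trans (k<end k₀) e≤s) λ ()
        (inj₂ (k , s<e , e′≤s)) → per k
          (≮⇒≥ λ k<k₀ → <-irrefl refl (<-≤-trans s<e (≤-trans (end-mono k<k₀) e≤s))) s<e e′≤s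

      from : EventualPeriod q → ∃ λ k₀ → ∀ k → k₀ ≤ k → PeriodicBlock k
      from (p , per) = p , λ k p≤k {s} _ e≤s → per s (≤-trans p≤k (≤-trans (<⇒≤ (k<end k)) e≤s))

  -- Pumped powers in the fixed point, and the two cases of the theorem.

  AllPowersOccur : Word n → Set
  AllPowersOccur w = ∀ j → ∃ λ s → At X s (pow w j)

  pumping⇒allPowersOccur : ∀ {a w} → Occurs a → ContainsAllPowers a w → AllPowersOccur w
  pumping⇒allPowersOccur {a} {w} (s , eq) powers j =
    let k , x , z , eq′ = powers j
        t , at = at-iter {s} k [ a ] (eq , Level.lift tt)
    in t + length x , proj₁ (at-++⁻ (pow w j) (proj₂ (at-++⁻ x (subst (At X t) eq′ at))))

  -- A power of w longer than preperiod + period + |w| reaches into the periodic part of W and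
  -- covers a whole period there.
  ultPeriodic⇒eventualPeriod : ∀ {m} (h : Fin n → Fin m) {w} → 0 < length w → AllPowersOccur w →
    UltPeriodic (code h X) → EventualPeriod h (length w)
  ultPeriodic⇒eventualPeriod h {w} 0<w powers (p , r , 0<r , per) = s + p , λ k s+p≤k →
    -- Reduction modulo the period `r` of `W` brings `k` to `s + p + i` with `i < r`, where it and
    -- its shift by `q` fall inside the power of `w`.
    let i , m , i<r , k≡ = residue 0<r s+p≤k in subst (λ k → W (k + q) ≡ W k) (sym k≡) (begin
      W (s + p + i + m * r + q)     ≡⟨ cong W (xy∙z≈xz∙y (s + p + i) (m * r) q) ⟩
      W (s + p + i + q + m * r)     ≡⟨ multiple m _ (≤-trans (p≤ i) (m≤m+n _ q)) ⟩
      W (s + p + i + q)             ≡⟨ base i<r ⟩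
      W (s + p + i)                 ≡⟨ multiple m _ (p≤ i) ⟨
      W (s + p + i + m * r)         ∎)
    where
    open ≡-Reasoning
    W = code h X
    q = length w
    -- Since `w` is nonempty, this many copies have length at least `q + p + r`.
    j = suc (p + r)
    s = proj₁ (powers j)
    at = proj₂ (powers j)

    p≤ : ∀ i → p ≤ s + p + i
    p≤ i = ≤-trans (m≤n+m p s) (m≤m+n (s + p) i)

    multiple : ∀ m k → p ≤ k → W (k + m * r) ≡ W k
    multiple m k p≤k = ascend 0<r {P = λ l → W l ≡ W k} (λ l p≤l e → trans (per l p≤l) e) m p≤k refl

    base : ∀ {i} → i < r → W (s + p + i + q) ≡ W (s + p + i)
    base {i} i<r = cong h (begin
      X (s + p + i + q)                    ≡⟨ cong (λ l → X (l + q)) (+-assoc s p i) ⟩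
      X (s + (p + i) + q)                  ≡⟨ cong X (trans (+-assoc s (p + i) q) (cong (s +_) (+-comm (p + i) q))) ⟩
      X (s + (q + (p + i)))                ≡⟨ at⇒nth {X = X} (X 0) (pow w j) at (inside lt) ⟨
      nth (X 0) (pow w j) (q + (p + i))    ≡⟨ nth-pow (X 0) w j lt ⟩
      nth (X 0) (pow w j) (p + i)          ≡⟨ at⇒nth {X = X} (X 0) (pow w j) at (inside (≤-<-trans (m≤n+m _ q) lt)) ⟩
      X (s + (p + i))                      ≡⟨ cong X (+-assoc s p i) ⟨
      X (s + p + i)                        ∎)
      where
      inside : ∀ {l} → l < j * q → l < length (pow w j)
      inside = subst (_ <_) (sym (length-pow w j))
      lt : q + (p + i) < j * q
      lt = +-monoʳ-< q (<-≤-trans (+-monoʳ-< p i<r) (m≤m*n (p + r) q {{>-nonZero 0<w}}))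

  -- A power of `w` with one copy more than the greatest length in `L` is a bounded factor too long
  -- to be listed.
  allPowersOccur⇒infinite : ∀ {w} → 0 < length w → All BoundedLetter w → AllPowersOccur w →
    ¬ FinitelyManyBoundedFactors φ X
  allPowersOccur⇒infinite {w} 0<w bw powers (L , complete) =
    <-irrefl refl (begin-strict
      length (pow w j)    ≤⟨ ∈-bounded (complete _ (factor⁺ (pow w j) (proj₂ (powers j)))
                                                (bounded⁺ (All-pow j bw))) ⟩
      M                   <⟨ n<1+n M ⟩
      j                   ≤⟨ m≤m*n j (length w) {{>-nonZero 0<w}} ⟩
      j * length w        ≡⟨ length-pow w j ⟨
      length (pow w j)    ∎)
    where
    open ≤-Reasoning
    M = max 0 (map length L)
    j = suc M
    ∈-bounded : ∀ {u} → u ∈ L → length u ≤ M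
    ∈-bounded u∈L = All.lookup (xs≤max 0 (map length L)) (∈-map⁺ length u∈L)

  -- Both conditions are decidable, so the words of length up to `M` can be filtered.
  boundedFactors : ∀ M → (∀ u → Factor X u → Bounded φ u → length u ≤ M) →
    Σ (List (Word n)) λ L → ∀ u → u ∈ L ⇔ (Factor X u × Bounded φ u)
  boundedFactors M short = filter P? (concatMap (words n) (upTo (suc M))) , λ u → mk⇔
    (proj₂ ∘ ∈-filter⁻ P? {xs = concatMap (words n) (upTo (suc M))})
    (λ (f , b) → ∈-filter⁺ P? (∈-concatMap⁺ (words n) (lose (∈-upTo⁺ (s≤s (short u f b))) (∈-words u))) (f , b))
    where
    P? : ∀ u → Dec (Factor X u × Bounded φ u)
    P? u = factor? u ×-dec bounded? u

  -- Letters that do not occur are tame vacuously; pumping from such a letter would say nothing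
  -- about `X`.
  Tame : Fin n → ℕ → Set
  Tame a K = Occurs a → (∀ k → PrefixBound K (iter φ k [ a ])) × (∀ k → SuffixBound K (iter φ k [ a ]))

  HasPumpedWord : Set
  HasPumpedWord = ∃ λ w → 0 < length w × All BoundedLetter w × AllPowersOccur w

  tame-or-pumped : ∀ a → ∃ (Tame a) ⊎ HasPumpedWord
  tame-or-pumped a with occurs? a | prefix-dichotomy a | suffix-dichotomy φ ne a
  ... | no ¬oa | _ | _ = inj₁ (0 , λ oa → contradiction oa ¬oa)
  ... | yes oa | inj₂ (w , 0<w , bw , powers) | _ = inj₂ (w , 0<w , bw , pumping⇒allPowersOccur oa powers)
  ... | yes oa | _ | inj₂ (w , 0<w , bw , powers) = inj₂ (w , 0<w , bw , pumping⇒allPowersOccur oa powers)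
  ... | yes _  | inj₁ (K , pre) | inj₁ (K′ , suf) = inj₁ (K ⊔ K′ , λ _ →
    (λ k y z eq by → ≤-trans (pre k y z eq by) (m≤m⊔n K K′)) ,
    (λ k z y eq by → ≤-trans (suf k z y eq by) (m≤n⊔m K K′)))

  -- Every factor lies in some `φᵏ(a₁)`, and the bound for the bounded factors there does not depend
  -- on `k`.
  tame⇒short : (∀ a → ∃ (Tame a)) → ∃ λ M → ∀ u → Factor X u → Bounded φ u → length u ≤ M
  tame⇒short tame with Fin-bounded (proj₁ ∘ tame) | Fin-bounded (length ∘ φ)
  ... | K , ≤K | S , ≤S = suc (S * K) , λ u fu bu →
    let s , at = factor⁻ fu
        x , z , eq = inPrefix u at
    in boundedFactor-length {Occurs} occurs-φ ≤S
         (λ {a} oa k y z eq by → ≤-trans (proj₁ (proj₂ (tame a) oa) k y z eq by) (≤K a))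
         (λ {a} oa k z y eq by → ≤-trans (proj₂ (proj₂ (tame a) oa) k z y eq by) (≤K a))
         -- This exponent is large enough because `prefix k` has more than `k` letters.
         (s + length u) {a₁} (0 , proj₁ (at-prefix 0)) x u z eq (bounded⁻ bu)
    where
    inPrefix : ∀ {s} u → At X s u → ∃₂ λ x z → prefix (s + length u) ≡ x ++ u ++ z
    inPrefix {s} u at
      with x , v , z , eq , refl , len ← split-middle (prefix (s + length u)) s (<⇒≤ (k<end (s + length u)))
      = x , z , trans eq (cong (λ t → x ++ t ++ z) (begin
          v                                     ≡⟨ at-middle x v (subst (At X 0) eq (at-prefix (s + length u))) ⟩
          window X (length x) (length v)        ≡⟨ cong (window X (length x)) len ⟩
          window X (length x) (length u)        ≡⟨ at⇒≡window u at ⟨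
          u                                     ∎))
      where open ≡-Reasoning

theorem4 : (n m : ℕ) (φ : Subst n) (a₁ : Fin n) (h : Fin n → Fin m) →
    NonErasing φ → ExtendsOver φ a₁ →
    (Σ (List (Word n)) λ L →
    ∀ u → u ∈ L ⇔ (Factor (fixpt φ a₁) u × Bounded φ u))
    ⊎ ((¬ FinitelyManyBoundedFactors φ (fixpt φ a₁))
    × Dec (UltPeriodic (code h (fixpt φ a₁))))
theorem4 n m φ a₁ h ne ext = conclude (Fin-all-or tame-or-pumped)
  where
  open FixedPoint φ ne a₁ ext
  conclude : (∀ a → ∃ (Tame a)) ⊎ HasPumpedWord →
    (Σ (List (Word n)) λ L → ∀ u → u ∈ L ⇔ (Factor X u × Bounded φ u))
    ⊎ ((¬ FinitelyManyBoundedFactors φ X) × Dec (UltPeriodic (code h X)))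
  conclude (inj₁ tame) = let M , short = tame⇒short tame in inj₁ (boundedFactors M short)
  conclude (inj₂ (w , 0<w , bw , powers)) = inj₂ (allPowersOccur⇒infinite 0<w bw powers ,
    -- `W` is ultimately periodic exactly when the single number `length w` is an eventual period,
    -- which is decidable.
    map′ (λ (p , per) → p , length w , 0<w , per) (ultPeriodic⇒eventualPeriod h 0<w powers)
      (eventualPeriod? h (length w)))
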